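{- Let $\gamma \geq 0$ be an integer. The vector space of $\gamma$-edge valued binary trees (with at least one internal node), endowed with the operations $\hookleftarrow_a, \hookrightarrow_a$, $a \in [\gamma]$, defined in the context, is the free $\gamma$-multiplicial algebra over one generator.
   Context: The ground field has characteristic zero; $[\gamma] = \{1, \dots, \gamma\}$; $a \downarrow a' := \min(a, a')$. A $\gamma$-multiplicial algebra is a vector space with binary linear operations $\hookleftarrow_a, \hookrightarrow_a$, $a \in [\gamma]$, satisfying for all elements $x, y, z$ and all $a, a' \in [\gamma]$: $(x \hookrightarrow_{a'} y) \hookleftarrow_a z = x \hookrightarrow_{a'} (y \hookleftarrow_a z)$; $(x \hookleftarrow_{a'} y) \hookleftarrow_a z = x \hookleftarrow_{a \downarrow a'} (y \hookleftarrow_a z)$; $(x \hookrightarrow_a y) \hookrightarrow_{a \downarrow a'} z = x \hookrightarrow_a (y \hookrightarrow_{a'} z)$. Free over one generator is meant in the category of such algebras (morphisms: linear maps commuting with all operations). A $\gamma$-edge valued binary tree is a planar binary tree (each internal node has exactly two children) with at least one internal node, in which every edge connecting two internal nodes is labeled by an element of $[\gamma]$. By convention, all edges connecting internal nodes with leaves are labeled by $\infty$, with $a \downarrow \infty = a = \infty \downarrow a$ for $a \in [\gamma]$. The operations are defined linearly as follows, for $\gamma$-edge valued binary trees $\mathfrak{s}$ and $\mathfrak{t}$ and $a \in [\gamma]$. The tree $\mathfrak{t} \hookleftarrow_a \mathfrak{s}$ is obtained by replacing the label $y$ of each edge of the rightmost path of $\mathfrak{t}$ (from the root to the rightmost leaf,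 including the last edge, labeled $\infty$) by $a \downarrow y$, and then grafting the root of $\mathfrak{s}$ on the rightmost leaf of the resulting tree (so the edge leading to the root of $\mathfrak{s}$ is labeled by $a$). Symmetrically, $\mathfrak{s} \hookrightarrow_a \mathfrak{t}$ is obtained by replacing the label $x$ of each edge of the leftmost path of $\mathfrak{t}$ (including the last edge, labeled $\infty$) by $a \downarrow x$, and then grafting the root of $\mathfrak{s}$ on the leftmost leaf of the resulting tree. -}

module Defs where

open import Agda.Primitive using (Setω)
open import Algebra.Bundles using (CommutativeRing)
import Algebra.Construct.NaturalChoice.Min as Min
import Algebra.Definitions.RawMonoid as RawMonoidDefinitions
open import Algebra.Module.Bundles using (Module)
open import Algebra.Module.Morphism.Structures using (IsModuleHomomorphism)
open import Algebra.Module.Structures using (IsModule)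
open import Algebra.Module.Structures.Biased using (IsModuleFromLeft)
import Algebra.Properties.Ring as RingProperties
open import Data.Bool.Base using (Bool; true; false; if_then_else_)
open import Data.Fin.Base using (Fin)
import Data.Fin.Properties as Fin
open import Data.List.Base using (List; []; _∷_; _++_; map; cartesianProductWith)
open import Data.Nat.Base using (ℕ)
open import Data.Product using (∃; ∃!; _×_; _,_; uncurry; map₁)
open import Function.Base using (flip)
open import Level using (Level; _⊔_; suc)
open import Relation.Binary.Definitions using (DecidableEquality)
open import Relation.Binary.PropositionalEquality using (_≡_; refl; cong₂)
open import Relation.Nullary using (¬_; does; yes; no)
open import Relation.Nullary.Decidable using (map′; _×-dec_)

record Field (c ℓ : Level) : Set (suc (c ⊔ ℓ)) where
  field
    commutativeRing : CommutativeRing c ℓ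
  open CommutativeRing commutativeRing public
  field
    1≉0     : ¬ (1# ≈ 0#)
    inverse : ∀ x → ¬ (x ≈ 0#) → ∃ λ y → x * y ≈ 1#

CharacteristicZero : ∀ {c ℓ} → Field c ℓ → Set ℓ
CharacteristicZero K = ∀ n → n · 1# ≈ 0# → n ≡ 0
  where
  open Field K
  open RawMonoidDefinitions +-rawMonoid using () renaming (_×_ to infixr 8 _·_)

-- The label set [γ] is represented by the γ-element chain Fin γ.

infixl 7 _↓_

_↓_ : ∀ {γ} → Fin γ → Fin γ → Fin γ
_↓_ {γ} = Min._⊓_ (Fin.≤-totalOrder γ)

record RawMultiplicialAlgebra {c ℓ} (K : Field c ℓ) (γ : ℕ) (m ℓm : Level)
                              : Set (c ⊔ ℓ ⊔ suc (m ⊔ ℓm)) where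
  infix 6 _↩[_]_ _↪[_]_
  field
    vectorSpace : Module (Field.commutativeRing K) m ℓm
  open Module vectorSpace public
  field
    _↩[_]_ : Carrierᴹ → Fin γ → Carrierᴹ → Carrierᴹ
    _↪[_]_ : Carrierᴹ → Fin γ → Carrierᴹ → Carrierᴹ

record IsMultiplicialAlgebra {c ℓ} {K : Field c ℓ} {γ : ℕ} {m ℓm : Level}
                             (A : RawMultiplicialAlgebra K γ m ℓm)
                             : Set (c ⊔ m ⊔ ℓm) where
  open RawMultiplicialAlgebra A
  field
    ↩-linearˡ : ∀ a y → IsModuleHomomorphism rawModule rawModule (λ x → x ↩[ a ] y)
    ↩-linearʳ : ∀ a x → IsModuleHomomorphism rawModule rawModule (λ y → x ↩[ a ] y)
    ↪-linearˡ : ∀ a y → IsModuleHomomorphism rawModule rawModule (λ x → x ↪[ a ] y)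
    ↪-linearʳ : ∀ a x → IsModuleHomomorphism rawModule rawModule (λ y → x ↪[ a ] y)
    ↪-↩-assoc : ∀ a a′ x y z →
      ((x ↪[ a′ ] y) ↩[ a ] z) ≈ᴹ (x ↪[ a′ ] (y ↩[ a ] z))
    ↩-↩-assoc : ∀ a a′ x y z →
      ((x ↩[ a′ ] y) ↩[ a ] z) ≈ᴹ (x ↩[ a ↓ a′ ] (y ↩[ a ] z))
    ↪-↪-assoc : ∀ a a′ x y z →
      ((x ↪[ a ] y) ↪[ a ↓ a′ ] z) ≈ᴹ (x ↪[ a ] (y ↪[ a′ ] z))

record MultiplicialAlgebra {c ℓ} (K : Field c ℓ) (γ : ℕ) (m ℓm : Level)
                           : Set (c ⊔ ℓ ⊔ suc (m ⊔ ℓm)) where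
  field
    rawMultiplicialAlgebra : RawMultiplicialAlgebra K γ m ℓm
    isMultiplicialAlgebra  : IsMultiplicialAlgebra rawMultiplicialAlgebra
  open RawMultiplicialAlgebra rawMultiplicialAlgebra public
  open IsMultiplicialAlgebra isMultiplicialAlgebra public

record IsMultiplicialHomomorphism
  {c ℓ} {K : Field c ℓ} {γ : ℕ} {m ℓm n ℓn : Level}
  (A : RawMultiplicialAlgebra K γ m ℓm) (B : RawMultiplicialAlgebra K γ n ℓn)
  (f : RawMultiplicialAlgebra.Carrierᴹ A → RawMultiplicialAlgebra.Carrierᴹ B)
  : Set (c ⊔ m ⊔ ℓm ⊔ ℓn) where
  private
    module A = RawMultiplicialAlgebra A
    module B = RawMultiplicialAlgebra B
  field
    isModuleHomomorphism : IsModuleHomomorphism A.rawModule B.rawModule f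
    ↩-homo : ∀ a x y → f (x A.↩[ a ] y) B.≈ᴹ (f x B.↩[ a ] f y)
    ↪-homo : ∀ a x y → f (x A.↪[ a ] y) B.≈ᴹ (f x B.↪[ a ] f y)

-- This lives in Setω because one generator must have the universal property
-- with respect to algebras in every universe.

record IsFreeMultiplicialAlgebraOnOneGenerator
  {c ℓ} {K : Field c ℓ} {γ : ℕ} {m ℓm : Level}
  (A : RawMultiplicialAlgebra K γ m ℓm) : Setω where
  open RawMultiplicialAlgebra A using (Carrierᴹ)
  field
    isMultiplicialAlgebra : IsMultiplicialAlgebra A
    generator             : Carrierᴹ
    universal             :
      ∀ {n ℓn} (B : MultiplicialAlgebra K γ n ℓn) →
      let module B = MultiplicialAlgebra B in
      (b : B.Carrierᴹ) →
      ∃! (λ f g → ∀ x → f x B.≈ᴹ g x)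
         (λ (f : Carrierᴹ → B.Carrierᴹ) →
            IsMultiplicialHomomorphism A B.rawMultiplicialAlgebra f
            × f generator B.≈ᴹ b)

-- A child is either a leaf, whose edge implicitly carries the label ∞, or an
-- edge labeled in [γ] leading to a subtree rooted at an internal node.

data Tree (γ : ℕ) : Set
data Child (γ : ℕ) : Set

data Tree γ where
  node : Child γ → Child γ → Tree γ

data Child γ where
  leaf : Child γ
  edge : Fin γ → Tree γ → Child γ

-- Relabelling along the path and grafting are done in a single traversal;
-- in the leaf case the new label is a ↓ ∞ = a.

infix 6 _↩ᵗ[_]_ _↪ᵗ[_]_

_↩ᵗ[_]_ : ∀ {γ} → Tree γ → Fin γ → Tree γ → Tree γ
node l leaf       ↩ᵗ[ a ] s = node l (edge a s)
node l (edge y r) ↩ᵗ[ a ] s = node l (edge (a ↓ y) (r ↩ᵗ[ a ] s))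

_↪ᵗ[_]_ : ∀ {γ} → Tree γ → Fin γ → Tree γ → Tree γ
s ↪ᵗ[ a ] node leaf       r = node (edge a s) r
s ↪ᵗ[ a ] node (edge x l) r = node (edge (a ↓ x) (s ↪ᵗ[ a ] l)) r

infix 4 _≟ᵗ_ _≟ᶜ_

_≟ᵗ_ : ∀ {γ} → DecidableEquality (Tree γ)
_≟ᶜ_ : ∀ {γ} → DecidableEquality (Child γ)

node l r ≟ᵗ node l′ r′ =
  map′ (uncurry (cong₂ node)) (λ { refl → refl , refl }) (l ≟ᶜ l′ ×-dec r ≟ᶜ r′)

leaf     ≟ᶜ leaf       = yes refl
leaf     ≟ᶜ edge _ _   = no λ ()
edge _ _ ≟ᶜ leaf       = no λ ()
edge a t ≟ᶜ edge a′ t′ =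
  map′ (uncurry (cong₂ edge)) (λ { refl → refl , refl }) (a Fin.≟ a′ ×-dec t ≟ᵗ t′)

-- The vector space with basis X: formal linear combinations, identified when
-- every basis element has the same total coefficient in both.

module FormalSums {c ℓ} (R : CommutativeRing c ℓ)
                  {X : Set} (_≟_ : DecidableEquality X) where

  open CommutativeRing R renaming (refl to ≈-refl; sym to ≈-sym; trans to ≈-trans)
  open RingProperties ring using (-0#≈0#; -‿+-comm)

  FormalSum : Set c
  FormalSum = List (Carrier × X)

  coeff : X → FormalSum → Carrier
  coeff t []             = 0#
  coeff t ((k , s) ∷ xs) = (if does (s ≟ t) then k else 0#) + coeff t xs

  infix 4 _≋_

  -- A record, so that both sides can be inferred from the type.
  record _≋_ (xs ys : FormalSum) : Set ℓ where
    constructor mk≋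
    field
      coeff-≈ : ∀ t → coeff t xs ≈ coeff t ys
  open _≋_ public

  scale : Carrier → FormalSum → FormalSum
  scale k = map (map₁ (k *_))

  negate : FormalSum → FormalSum
  negate = map (map₁ λ k → - k)

  bilinear : (X → X → X) → FormalSum → FormalSum → FormalSum
  bilinear _∙_ = cartesianProductWith λ (k , s) (l , t) → k * l , s ∙ t

  coeff-++ : ∀ xs ys t → coeff t (xs ++ ys) ≈ coeff t xs + coeff t ys
  coeff-++ []       ys t = ≈-sym (+-identityˡ _)
  coeff-++ (x ∷ xs) ys t =
    ≈-trans (+-congˡ (coeff-++ xs ys t)) (≈-sym (+-assoc _ _ _))

  private
    if-* : ∀ (b : Bool) k l → (if b then k * l else 0#) ≈ k * (if b then l else 0#)
    if-* true  k l = ≈-refl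
    if-* false k l = ≈-sym (zeroʳ k)

    if-- : ∀ (b : Bool) k → (if b then - k else 0#) ≈ - (if b then k else 0#)
    if-- true  k = ≈-refl
    if-- false k = ≈-sym -0#≈0#

  coeff-scale : ∀ k xs t → coeff t (scale k xs) ≈ k * coeff t xs
  coeff-scale k []             t = ≈-sym (zeroʳ k)
  coeff-scale k ((l , s) ∷ xs) t =
    ≈-trans (+-cong (if-* (does (s ≟ t)) k l) (coeff-scale k xs t))
            (≈-sym (distribˡ k _ _))

  coeff-negate : ∀ xs t → coeff t (negate xs) ≈ - coeff t xs
  coeff-negate []             t = ≈-sym -0#≈0#
  coeff-negate ((l , s) ∷ xs) t =
    ≈-trans (+-cong (if-- (does (s ≟ t)) l) (coeff-negate xs t)) (-‿+-comm _ _)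

  private
    -- Reduces an equation of formal sums to one between coefficients.
    via : ∀ {xs ys} {f g : X → Carrier} →
          (∀ t → coeff t xs ≈ f t) → (∀ t → coeff t ys ≈ g t) →
          (∀ t → f t ≈ g t) → xs ≋ ys
    via p q e = mk≋ λ t → ≈-trans (p t) (≈-trans (e t) (≈-sym (q t)))

  isModule : IsModule R _≋_ _++_ [] negate scale (flip scale)
  isModule = IsModuleFromLeft.isModule {commutativeRing = R} record
    { isLeftModule = record
      { isLeftSemimodule = record
        { +ᴹ-isCommutativeMonoid = record
          { isMonoid = record
            { isSemigroup = record
              { isMagma = record
                { isEquivalence = record
                  { refl  = mk≋ λ t → ≈-refl
                  ; sym   = λ p → mk≋ λ t → ≈-sym (coeff-≈ p t)
                  ; trans = λ p q → mk≋ λ t → ≈-trans (coeff-≈ p t) (coeff-≈ q t)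
                  }
                ; ∙-cong = λ {xs} {ys} {us} {vs} p q →
                    via (coeff-++ xs us) (coeff-++ ys vs)
                      (λ t → +-cong (coeff-≈ p t) (coeff-≈ q t))
                }
              ; assoc = λ xs ys zs →
                  via (λ t → ≈-trans (coeff-++ (xs ++ ys) zs t)
                                     (+-congʳ (coeff-++ xs ys t)))
                          (λ t → ≈-trans (coeff-++ xs (ys ++ zs) t)
                                         (+-congˡ (coeff-++ ys zs t)))
                          (λ t → +-assoc _ _ _)
              }
            ; identity = (λ xs → mk≋ λ t → ≈-refl)
                       , (λ xs → mk≋ λ t → ≈-trans (coeff-++ xs [] t) (+-identityʳ _))
            }
          ; comm = λ xs ys → via (coeff-++ xs ys) (coeff-++ ys xs) (λ t → +-comm _ _)
          }
        ; isPreleftSemimodule = record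
          { *ₗ-cong      = λ {k} {l} {xs} {ys} k≈l p →
              via (coeff-scale k xs) (coeff-scale l ys) (λ t → *-cong k≈l (coeff-≈ p t))
          ; *ₗ-zeroˡ     = λ xs → via (coeff-scale 0# xs) (λ t → ≈-refl) (λ t → zeroˡ _)
          ; *ₗ-distribʳ  = λ xs k l →
              via (coeff-scale (k + l) xs)
                (λ t → ≈-trans (coeff-++ (scale k xs) (scale l xs) t)
                               (+-cong (coeff-scale k xs t) (coeff-scale l xs t)))
                (λ t → distribʳ _ k l)
          ; *ₗ-identityˡ = λ xs → via (coeff-scale 1# xs) (λ t → ≈-refl) (λ t → *-identityˡ _)
          ; *ₗ-assoc     = λ k l xs →
              via (coeff-scale (k * l) xs)
                (λ t → ≈-trans (coeff-scale k (scale l xs) t) (*-congˡ (coeff-scale l xs t)))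
                (λ t → *-assoc k l _)
          ; *ₗ-zeroʳ     = λ k → mk≋ λ t → ≈-refl
          ; *ₗ-distribˡ  = λ k xs ys →
              via (λ t → ≈-trans (coeff-scale k (xs ++ ys) t) (*-congˡ (coeff-++ xs ys t)))
                (λ t → ≈-trans (coeff-++ (scale k xs) (scale k ys) t)
                               (+-cong (coeff-scale k xs t) (coeff-scale k ys t)))
                (λ t → distribˡ k _ _)
          }
        }
      ; -ᴹ‿cong    = λ {xs} {ys} p →
          via (coeff-negate xs) (coeff-negate ys)
            (λ t → -‿cong (coeff-≈ p t))
      ; -ᴹ‿inverse =
          (λ xs → via (λ t → ≈-trans (coeff-++ (negate xs) xs t)
                                     (+-congʳ (coeff-negate xs t)))
                          (λ t → ≈-refl) (λ t → -‿inverseˡ _))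
        , (λ xs → via (λ t → ≈-trans (coeff-++ xs (negate xs) t)
                                     (+-congˡ (coeff-negate xs t)))
                          (λ t → ≈-refl) (λ t → -‿inverseʳ _))
      }
    }

  formalSumModule : Module R c ℓ
  formalSumModule = record { isModule = isModule }

treeAlgebra : ∀ {c ℓ} (K : Field c ℓ) (γ : ℕ) → RawMultiplicialAlgebra K γ c ℓ
treeAlgebra K γ = record
  { vectorSpace = formalSumModule
  ; _↩[_]_      = λ xs a ys → bilinear (_↩ᵗ[ a ]_) xs ys
  ; _↪[_]_      = λ xs a ys → bilinear (_↪ᵗ[ a ]_) xs ys
  }
  where open FormalSums (Field.commutativeRing K) (_≟ᵗ_ {γ})

{-# OPTIONS --safe #-}
module Submission where

-- Since ↪-↩-assoc lets s ↪[ a ] and ↩[ b ] t act on the root in either order,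
-- each tree is a word in the one-node tree built by grafting first its left and
-- then its right subtree. Evaluating this word in an algebra B at b is forced on
-- any homomorphism, and the two remaining relations are exactly what is needed for
-- a graft along the rightmost (leftmost) path to evaluate to the product in B.
-- Everything else is multilinear, hence is checked on basis trees. Constructively,
-- linear extensions are well defined because a formal sum with zero coefficients
-- can be emptied by collecting and removing one basis element at a time.

open import Defs
open import Algebra.Bundles using (CommutativeMonoid; CommutativeRing)
import Algebra.Construct.NaturalChoice.MinOp as MinOp
import Algebra.Construct.NaturalChoice.Min as Min
open import Algebra.Module.Bundles using (Module)
open import Algebra.Module.Morphism.Construct.Composition using (isModuleHomomorphism)
open import Algebra.Module.Morphism.Structures using (IsModuleHomomorphism)
import Algebra.Properties.AbelianGroup as AbelianGroupProperties
import Algebra.Properties.CommutativeSemigroup as CommutativeSemigroupProperties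
import Algebra.Properties.Ring as RingProperties
open import Data.Bool.Base using (Bool; true; false; if_then_else_)
open import Data.Fin.Base using (Fin)
import Data.Fin.Properties as Fin
open import Data.List.Base using ([]; _∷_; [_]; _++_; map; filter; length)
open import Data.List.Properties using (map-∘; filter-notAll)
open import Data.List.Relation.Unary.Any using (here)
open import Data.Nat.Base using (ℕ; _<_)
open import Data.Nat.Induction using (<-wellFounded)
open import Data.Product using (_,_; map₂)
open import Induction.WellFounded using (Acc; acc)
open import Relation.Binary.Definitions using (DecidableEquality)
open import Relation.Binary.PropositionalEquality using (_≡_; _≢_; refl; sym; cong; cong₂)
import Relation.Binary.Reasoning.Setoid as SetoidReasoning
open import Relation.Nullary using (does; yes; no; ¬?)
open import Relation.Nullary.Decidable using (dec-false)

-- Linear maps between modules over a commutative ring.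

module _ {r ℓr} {R : CommutativeRing r ℓr} where

  -- Zero is `0# *ₗ 0ᴹ`, so homogeneity preserves it; negation then follows from uniqueness of
  -- inverses, and the right action from its coincidence with the left one.
  additive∧homogeneous⇒linear :
    ∀ {m ℓm n ℓn} (M : Module R m ℓm) (N : Module R n ℓn) →
    let module M = Module M
        module N = Module N in
    {f : M.Carrierᴹ → N.Carrierᴹ} →
    (∀ {x y} → x M.≈ᴹ y → f x N.≈ᴹ f y) →
    (∀ x y → f (x M.+ᴹ y) N.≈ᴹ f x N.+ᴹ f y) →
    (∀ k x → f (k M.*ₗ x) N.≈ᴹ k N.*ₗ f x) →
    IsModuleHomomorphism M.rawModule N.rawModule f
  additive∧homogeneous⇒linear M N {f} f-cong f-+ f-*ₗ = record
    { isBimoduleHomomorphism = record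
      { +ᴹ-isGroupHomomorphism = record
        { isMonoidHomomorphism = record
          { isMagmaHomomorphism = record
            { isRelHomomorphism = record { cong = f-cong }
            ; homo              = f-+
            }
          ; ε-homo = f-0
          }
        ; ⁻¹-homo = λ x → N-group.inverseʳ-unique (f x) (f (M.-ᴹ x))
            (N.≈ᴹ-trans (N.≈ᴹ-sym (f-+ _ _))
              (N.≈ᴹ-trans (f-cong (M.-ᴹ‿inverseʳ x)) f-0))
        }
      ; *ₗ-homo = f-*ₗ
      ; *ᵣ-homo = λ k x →
          N.≈ᴹ-trans (f-cong (M.≈ᴹ-sym (M.*ₗ-*ᵣ-coincident k x)))
            (N.≈ᴹ-trans (f-*ₗ k x) (N.*ₗ-*ᵣ-coincident k (f x)))
      }
    }
    where
    module M = Module M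
    module N = Module N
    module N-group = AbelianGroupProperties N.+ᴹ-abelianGroup
    f-0 : f M.0ᴹ N.≈ᴹ N.0ᴹ
    f-0 = N.≈ᴹ-trans (f-cong (M.≈ᴹ-sym (M.*ₗ-zeroˡ M.0ᴹ)))
            (N.≈ᴹ-trans (f-*ₗ _ M.0ᴹ) (N.*ₗ-zeroˡ (f M.0ᴹ)))

-- Formal sums and the removal of a basis element.

module FormalSumProperties {c ℓ} (R : CommutativeRing c ℓ)
                           {X : Set} (_≟_ : DecidableEquality X) where

  open CommutativeRing R renaming (refl to ≈-refl; sym to ≈-sym; trans to ≈-trans)
  open RingProperties ring using (-1*x≈-x)
  open FormalSums R _≟_
  private module FS = Module formalSumModule

  ⟨_⟩ : X → FormalSum
  ⟨ t ⟩ = [ 1# , t ]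

  singleton-cong : ∀ {k l} t → k ≈ l → [ k , t ] ≋ [ l , t ]
  singleton-cong {k} {l} t k≈l = mk≋ λ u → +-congʳ (if-cong (does (t ≟ u)))
    where
    if-cong : ∀ (b : Bool) → (if b then k else 0#) ≈ (if b then l else 0#)
    if-cong true  = k≈l
    if-cong false = ≈-refl

  ∷≋scale : ∀ k t xs → (k , t) ∷ xs ≋ scale k ⟨ t ⟩ ++ xs
  ∷≋scale k t xs =
    FS.+ᴹ-congʳ (singleton-cong t (≈-sym (*-identityʳ k)))

  erase : X → FormalSum → FormalSum
  erase s = filter (λ (_ , t) → ¬? (t ≟ s))

  coeff-erase-≡ : ∀ s xs → coeff s (erase s xs) ≈ 0#
  coeff-erase-≡ s [] = ≈-refl
  coeff-erase-≡ s ((k , t) ∷ xs) with t ≟ s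
  ... | yes _  = coeff-erase-≡ s xs
  ... | no t≢s rewrite dec-false (t ≟ s) t≢s =
    ≈-trans (+-identityˡ _) (coeff-erase-≡ s xs)

  coeff-erase-≢ : ∀ {s t} → s ≢ t → ∀ xs → coeff t (erase s xs) ≈ coeff t xs
  coeff-erase-≢ s≢t [] = ≈-refl
  coeff-erase-≢ {s} {t} s≢t ((k , u) ∷ xs) with u ≟ s
  ... | yes refl rewrite dec-false (s ≟ t) s≢t =
    ≈-trans (coeff-erase-≢ s≢t xs) (≈-sym (+-identityˡ _))
  ... | no _ = +-congˡ (coeff-erase-≢ s≢t xs)

  erase-≋[] : ∀ s {xs} → xs ≋ [] → erase s xs ≋ []
  erase-≋[] s {xs} xs≋[] = mk≋ coeff≈0
    where
    coeff≈0 : ∀ t → coeff t (erase s xs) ≈ 0#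
    coeff≈0 t with s ≟ t
    ... | yes refl = coeff-erase-≡ s xs
    ... | no s≢t   = ≈-trans (coeff-erase-≢ s≢t xs) (coeff-≈ xs≋[] t)

  -- At least the head is dropped, which makes the length a termination measure for `extension-≋[]`.
  length-erase : ∀ k s xs → length (erase s ((k , s) ∷ xs)) < length ((k , s) ∷ xs)
  length-erase k s xs =
    filter-notAll (λ (_ , t) → ¬? (t ≟ s)) ((k , s) ∷ xs) (here λ s≢s → s≢s refl)

  -- Linear extension from the basis.

  module _ {m ℓm} (M : Module R m ℓm) where

    open Module M
    open SetoidReasoning ≈ᴹ-setoid
    open CommutativeSemigroupProperties
      (CommutativeMonoid.commutativeSemigroup +ᴹ-commutativeMonoid)
      using (x∙yz≈y∙xz)
    open AbelianGroupProperties +ᴹ-abelianGroup using (∙-cancelʳ)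

    -- The equations on g say that g is the linear extension of f; they are not
    -- stated about one fixed extension so that bilinear is covered as well.
    module _ (f : X → Carrierᴹ) (g : FormalSum → Carrierᴹ)
             (g-[] : g [] ≈ᴹ 0ᴹ)
             (g-∷  : ∀ k t xs → g ((k , t) ∷ xs) ≈ᴹ k *ₗ f t +ᴹ g xs) where

      -- All terms on `s`, wherever they stand in the list, are collected into one term carrying
      -- their total coefficient.
      extension-erase : ∀ s xs → g xs ≈ᴹ coeff s xs *ₗ f s +ᴹ g (erase s xs)
      extension-erase s [] = ≈ᴹ-sym (begin
        0# *ₗ f s +ᴹ g []  ≈⟨ +ᴹ-congʳ (*ₗ-zeroˡ _) ⟩
        0ᴹ +ᴹ g []         ≈⟨ +ᴹ-identityˡ _ ⟩
        g []               ∎)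
      extension-erase s ((k , t) ∷ xs) with t ≟ s
      ... | yes refl = begin
        g ((k , s) ∷ xs)                                        ≈⟨ g-∷ k s xs ⟩
        k *ₗ f s +ᴹ g xs                                        ≈⟨ +ᴹ-congˡ (extension-erase s xs) ⟩
        k *ₗ f s +ᴹ (coeff s xs *ₗ f s +ᴹ g (erase s xs))       ≈⟨ +ᴹ-assoc _ _ _ ⟨
        (k *ₗ f s +ᴹ coeff s xs *ₗ f s) +ᴹ g (erase s xs)       ≈⟨ +ᴹ-congʳ (*ₗ-distribʳ _ _ _) ⟨
        (k + coeff s xs) *ₗ f s +ᴹ g (erase s xs)               ∎
      ... | no _ = begin
        g ((k , t) ∷ xs)                                        ≈⟨ g-∷ k t xs ⟩
        k *ₗ f t +ᴹ g xs                                        ≈⟨ +ᴹ-congˡ (extension-erase s xs) ⟩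
        k *ₗ f t +ᴹ (coeff s xs *ₗ f s +ᴹ g (erase s xs))       ≈⟨ x∙yz≈y∙xz _ _ _ ⟩
        coeff s xs *ₗ f s +ᴹ (k *ₗ f t +ᴹ g (erase s xs))       ≈⟨ +ᴹ-cong (*ₗ-congʳ (+-identityˡ _)) (g-∷ k t _) ⟨
        (0# + coeff s xs) *ₗ f s +ᴹ g ((k , t) ∷ erase s xs)    ∎

      extension-≋[] : ∀ xs → Acc _<_ (length xs) → xs ≋ [] → g xs ≈ᴹ 0ᴹ
      extension-≋[] []                  _         _     = g-[]
      extension-≋[] xs@((k , s) ∷ xs′) (acc rec) xs≋[] = begin
        g xs                                ≈⟨ extension-erase s xs ⟩
        coeff s xs *ₗ f s +ᴹ g (erase s xs) ≈⟨ +ᴹ-cong (*ₗ-congʳ (coeff-≈ xs≋[] s))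
                                                 (extension-≋[] (erase s xs) (rec (length-erase k s xs′)) (erase-≋[] s xs≋[])) ⟩
        0# *ₗ f s +ᴹ 0ᴹ                     ≈⟨ +ᴹ-identityʳ _ ⟩
        0# *ₗ f s                           ≈⟨ *ₗ-zeroˡ _ ⟩
        0ᴹ                                  ∎

      extension-++ : ∀ xs ys → g (xs ++ ys) ≈ᴹ g xs +ᴹ g ys
      extension-++ [] ys = ≈ᴹ-trans (≈ᴹ-sym (+ᴹ-identityˡ _)) (+ᴹ-congʳ (≈ᴹ-sym g-[]))
      extension-++ ((k , t) ∷ xs) ys = begin
        g ((k , t) ∷ xs ++ ys)          ≈⟨ g-∷ k t (xs ++ ys) ⟩
        k *ₗ f t +ᴹ g (xs ++ ys)        ≈⟨ +ᴹ-congˡ (extension-++ xs ys) ⟩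
        k *ₗ f t +ᴹ (g xs +ᴹ g ys)      ≈⟨ +ᴹ-assoc _ _ _ ⟨
        (k *ₗ f t +ᴹ g xs) +ᴹ g ys      ≈⟨ +ᴹ-congʳ (g-∷ k t xs) ⟨
        g ((k , t) ∷ xs) +ᴹ g ys        ∎

      extension-scale : ∀ k xs → g (scale k xs) ≈ᴹ k *ₗ g xs
      extension-scale k [] =
        ≈ᴹ-trans g-[] (≈ᴹ-trans (≈ᴹ-sym (*ₗ-zeroʳ k)) (*ₗ-congˡ (≈ᴹ-sym g-[])))
      extension-scale k ((l , t) ∷ xs) = begin
        g ((k * l , t) ∷ scale k xs)       ≈⟨ g-∷ (k * l) t (scale k xs) ⟩
        (k * l) *ₗ f t +ᴹ g (scale k xs)   ≈⟨ +ᴹ-cong (*ₗ-assoc k l _) (extension-scale k xs) ⟩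
        k *ₗ l *ₗ f t +ᴹ k *ₗ g xs         ≈⟨ *ₗ-distribˡ k _ _ ⟨
        k *ₗ (l *ₗ f t +ᴹ g xs)            ≈⟨ *ₗ-congˡ (g-∷ l t xs) ⟨
        k *ₗ g ((l , t) ∷ xs)              ∎

      extension-cong : ∀ {xs ys} → xs ≋ ys → g xs ≈ᴹ g ys
      -- Both `g xs` and `g ys` become zero on adding `- 1# *ₗ g ys`, so this summand cancels.
      extension-cong {xs} {ys} xs≋ys = ∙-cancelʳ (- 1# *ₗ g ys) _ _
        (≈ᴹ-trans (difference xs xs≋ys) (≈ᴹ-sym (difference ys FS.≈ᴹ-refl)))
        where
        difference-≋[] : ∀ zs → zs ≋ ys → zs ++ scale (- 1#) ys ≋ []
        difference-≋[] zs zs≋ys = mk≋ λ t →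
          ≈-trans (coeff-++ zs _ t)
            (≈-trans (+-cong (coeff-≈ zs≋ys t)
                             (≈-trans (coeff-scale (- 1#) ys t) (-1*x≈-x _)))
                     (-‿inverseʳ _))
        difference : ∀ zs → zs ≋ ys → g zs +ᴹ - 1# *ₗ g ys ≈ᴹ 0ᴹ
        difference zs zs≋ys = begin
          g zs +ᴹ - 1# *ₗ g ys          ≈⟨ +ᴹ-congˡ (extension-scale (- 1#) ys) ⟨
          g zs +ᴹ g (scale (- 1#) ys)   ≈⟨ extension-++ zs _ ⟨
          g (zs ++ scale (- 1#) ys)     ≈⟨ extension-≋[] _ (<-wellFounded _) (difference-≋[] zs zs≋ys) ⟩
          0ᴹ                            ∎

      extension-linear : IsModuleHomomorphism FS.rawModule rawModule g
      extension-linear = additive∧homogeneous⇒linear formalSumModule M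
        extension-cong extension-++ extension-scale

    extend : (X → Carrierᴹ) → FormalSum → Carrierᴹ
    extend f []             = 0ᴹ
    extend f ((k , t) ∷ xs) = k *ₗ f t +ᴹ extend f xs

    extend-linear : ∀ f → IsModuleHomomorphism FS.rawModule rawModule (extend f)
    extend-linear f = extension-linear f (extend f) ≈ᴹ-refl λ _ _ _ → ≈ᴹ-refl

    extend-⟨⟩ : ∀ f t → extend f ⟨ t ⟩ ≈ᴹ f t
    extend-⟨⟩ f t = ≈ᴹ-trans (+ᴹ-identityʳ _) (*ₗ-identityˡ _)

    -- Up to `≋`, a nonempty list is a scaled basis element plus its tail, so linearity leaves only
    -- the values on the basis to compare.
    linear-ext : ∀ {f g : FormalSum → Carrierᴹ} →
                 IsModuleHomomorphism FS.rawModule rawModule f →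
                 IsModuleHomomorphism FS.rawModule rawModule g →
                 (∀ t → f ⟨ t ⟩ ≈ᴹ g ⟨ t ⟩) → ∀ xs → f xs ≈ᴹ g xs
    linear-ext {f} {g} f-linear g-linear f≈g = go
      where
      module F = IsModuleHomomorphism f-linear
      module G = IsModuleHomomorphism g-linear
      go : ∀ xs → f xs ≈ᴹ g xs
      go []             = ≈ᴹ-trans F.0ᴹ-homo (≈ᴹ-sym G.0ᴹ-homo)
      go ((k , t) ∷ xs) = begin
        f ((k , t) ∷ xs)          ≈⟨ F.⟦⟧-cong (∷≋scale k t xs) ⟩
        f (scale k ⟨ t ⟩ ++ xs)   ≈⟨ F.+ᴹ-homo _ _ ⟩
        f (scale k ⟨ t ⟩) +ᴹ f xs ≈⟨ +ᴹ-congʳ (F.*ₗ-homo k _) ⟩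
        k *ₗ f ⟨ t ⟩ +ᴹ f xs      ≈⟨ +ᴹ-cong (*ₗ-congˡ (f≈g t)) (go xs) ⟩
        k *ₗ g ⟨ t ⟩ +ᴹ g xs      ≈⟨ +ᴹ-congʳ (G.*ₗ-homo k _) ⟨
        g (scale k ⟨ t ⟩) +ᴹ g xs ≈⟨ G.+ᴹ-homo _ _ ⟨
        g (scale k ⟨ t ⟩ ++ xs)   ≈⟨ G.⟦⟧-cong (∷≋scale k t xs) ⟨
        g ((k , t) ∷ xs)          ∎

  -- Bilinear operations on formal sums and reduction to the basis.

  bilinear-⟨⟩ : ∀ (_∙_ : X → X → X) s t → bilinear _∙_ ⟨ s ⟩ ⟨ t ⟩ ≋ ⟨ s ∙ t ⟩
  bilinear-⟨⟩ _∙_ s t = singleton-cong (s ∙ t) (*-identityˡ 1#)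

  -- For fixed `ys` this is the linear extension of `s ↦ map (map₂ (s ∙_)) ys`; its equations hold
  -- up to fusing two maps.
  bilinear-linearˡ : ∀ (_∙_ : X → X → X) ys →
    IsModuleHomomorphism FS.rawModule FS.rawModule (λ xs → bilinear _∙_ xs ys)
  bilinear-linearˡ _∙_ ys =
    extension-linear formalSumModule (λ s → map (map₂ (s ∙_)) ys) _ FS.≈ᴹ-refl
      λ k s xs → FS.+ᴹ-congʳ (FS.≈ᴹ-reflexive (map-∘ ys))

  bilinear-linearʳ : ∀ (_∙_ : X → X → X) xs →
    IsModuleHomomorphism FS.rawModule FS.rawModule (λ ys → bilinear _∙_ xs ys)
  bilinear-linearʳ _∙_ xs =
    extension-linear formalSumModule (λ t → map (map₂ (_∙ t)) xs) _ (bilinear-[] xs)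
      λ l t ys → bilinear-∷ l t ys xs
    where
    open CommutativeSemigroupProperties
      (CommutativeMonoid.commutativeSemigroup FS.+ᴹ-commutativeMonoid)
      using (x∙yz≈y∙xz)

    bilinear-[] : ∀ xs → bilinear _∙_ xs [] ≋ []
    bilinear-[] []       = FS.≈ᴹ-refl
    bilinear-[] (x ∷ xs) = bilinear-[] xs

    -- The product list is built by recursion on its left factor, so the terms coming from `(l , t)`
    -- are scattered through it. They are brought to the front, and their coefficients are commuted.
    bilinear-∷ : ∀ l t ys xs →
      bilinear _∙_ xs ((l , t) ∷ ys) ≋
      scale l (map (map₂ (_∙ t)) xs) ++ bilinear _∙_ xs ys
    bilinear-∷ l t ys []             = FS.≈ᴹ-refl
    bilinear-∷ l t ys ((k , s) ∷ xs) =
      FS.+ᴹ-cong (singleton-cong (s ∙ t) (*-comm k l))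
        (FS.≈ᴹ-trans (FS.+ᴹ-congˡ (bilinear-∷ l t ys xs))
          (x∙yz≈y∙xz (map _ ys) (scale l (map _ xs)) _))

  -- Both sides are linear in each argument, so the arguments are replaced by basis elements one at
  -- a time. Four operations are allowed because the multiplicial relations mix labels and sides.
  bilinear-assoc : ∀ (_∙_ _∘_ _⋄_ _⋆_ : X → X → X) →
    (∀ s t u → (s ∙ t) ∘ u ≡ s ⋄ (t ⋆ u)) → ∀ xs ys zs →
    bilinear _∘_ (bilinear _∙_ xs ys) zs ≋ bilinear _⋄_ xs (bilinear _⋆_ ys zs)
  bilinear-assoc _∙_ _∘_ _⋄_ _⋆_ assoc xs ys zs =
    linear-ext formalSumModule
      (bilinear-linearˡ _∙_ ys ⨾ bilinear-linearˡ _∘_ zs)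
      (bilinear-linearˡ _⋄_ (bilinear _⋆_ ys zs))
      (λ s → linear-ext formalSumModule
        (bilinear-linearʳ _∙_ ⟨ s ⟩ ⨾ bilinear-linearˡ _∘_ zs)
        (bilinear-linearˡ _⋆_ zs ⨾ bilinear-linearʳ _⋄_ ⟨ s ⟩)
        (λ t → linear-ext formalSumModule
          (bilinear-linearʳ _∘_ (bilinear _∙_ ⟨ s ⟩ ⟨ t ⟩))
          (bilinear-linearʳ _⋆_ ⟨ t ⟩ ⨾ bilinear-linearʳ _⋄_ ⟨ s ⟩)
          (λ u → assoc-⟨⟩ s t u) zs)
        ys)
      xs
    where
    _⨾_ : ∀ {f g} → IsModuleHomomorphism FS.rawModule FS.rawModule f →
          IsModuleHomomorphism FS.rawModule FS.rawModule g →
          IsModuleHomomorphism FS.rawModule FS.rawModule (λ xs → g (f xs))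
    _⨾_ = isModuleHomomorphism FS.≈ᴹ-trans

    assoc-⟨⟩ : ∀ s t u →
      bilinear _∘_ (bilinear _∙_ ⟨ s ⟩ ⟨ t ⟩) ⟨ u ⟩ ≋
      bilinear _⋄_ ⟨ s ⟩ (bilinear _⋆_ ⟨ t ⟩ ⟨ u ⟩)
    assoc-⟨⟩ s t u rewrite assoc s t u = singleton-cong _ (*-assoc 1# 1# 1#)

  -- The same reduction, in two arguments, turns compatibility with grafting on trees into
  -- compatibility on all formal sums.
  extend-bilinear : ∀ {m ℓm} (M : Module R m ℓm) → let open Module M in
    (_∙_ : X → X → X) (_⊙_ : Carrierᴹ → Carrierᴹ → Carrierᴹ) →
    (∀ y → IsModuleHomomorphism rawModule rawModule (_⊙ y)) →
    (∀ x → IsModuleHomomorphism rawModule rawModule (x ⊙_)) →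
    (f : X → Carrierᴹ) → (∀ s t → f (s ∙ t) ≈ᴹ f s ⊙ f t) → ∀ xs ys →
    extend M f (bilinear _∙_ xs ys) ≈ᴹ extend M f xs ⊙ extend M f ys
  extend-bilinear M _∙_ _⊙_ ⊙-linearˡ ⊙-linearʳ f f-∙ xs ys =
    linear-ext M
      (isModuleHomomorphism ≈ᴹ-trans (bilinear-linearˡ _∙_ ys) F-linear)
      (isModuleHomomorphism ≈ᴹ-trans F-linear (⊙-linearˡ (F ys)))
      (λ s → linear-ext M
        (isModuleHomomorphism ≈ᴹ-trans (bilinear-linearʳ _∙_ ⟨ s ⟩) F-linear)
        (isModuleHomomorphism ≈ᴹ-trans F-linear (⊙-linearʳ (F ⟨ s ⟩)))
        (λ t → homo-⟨⟩ s t) ys)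
      xs
    where
    open Module M
    open SetoidReasoning ≈ᴹ-setoid
    open IsModuleHomomorphism using (⟦⟧-cong)
    F = extend M f
    F-linear = extend-linear M f

    homo-⟨⟩ : ∀ s t → F (bilinear _∙_ ⟨ s ⟩ ⟨ t ⟩) ≈ᴹ F ⟨ s ⟩ ⊙ F ⟨ t ⟩
    homo-⟨⟩ s t = begin
      F (bilinear _∙_ ⟨ s ⟩ ⟨ t ⟩)  ≈⟨ ⟦⟧-cong F-linear (bilinear-⟨⟩ _∙_ s t) ⟩
      F ⟨ s ∙ t ⟩                   ≈⟨ extend-⟨⟩ M f (s ∙ t) ⟩
      f (s ∙ t)                     ≈⟨ f-∙ s t ⟩
      f s ⊙ f t                     ≈⟨ ⟦⟧-cong (⊙-linearˡ (f t)) (extend-⟨⟩ M f s) ⟨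
      F ⟨ s ⟩ ⊙ f t                 ≈⟨ ⟦⟧-cong (⊙-linearʳ (F ⟨ s ⟩)) (extend-⟨⟩ M f t) ⟨
      F ⟨ s ⟩ ⊙ F ⟨ t ⟩             ∎

-- The multiplicial relations on basis trees.

module _ {γ : ℕ} where

  ↓-assoc : ∀ (a b c : Fin γ) → (a ↓ b) ↓ c ≡ a ↓ (b ↓ c)
  ↓-assoc = MinOp.⊓-assoc (Min.minOperator (Fin.≤-totalOrder γ))

  -- The two grafts change different children of the root of `t`, so each case is a computation.
  ↪ᵗ-↩ᵗ-assoc : ∀ a a′ (s t u : Tree γ) →
    (s ↪ᵗ[ a′ ] t) ↩ᵗ[ a ] u ≡ s ↪ᵗ[ a′ ] (t ↩ᵗ[ a ] u)
  ↪ᵗ-↩ᵗ-assoc a a′ s (node leaf       leaf)       u = refl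
  ↪ᵗ-↩ᵗ-assoc a a′ s (node leaf       (edge y r)) u = refl
  ↪ᵗ-↩ᵗ-assoc a a′ s (node (edge x l) leaf)       u = refl
  ↪ᵗ-↩ᵗ-assoc a a′ s (node (edge x l) (edge y r)) u = refl

  -- On the right path of `s`, an old label `y` is lowered by both `a` and `a′`, and the new edge to
  -- `t`, labeled `a′`, is lowered to `a ↓ a′`.
  ↩ᵗ-↩ᵗ-assoc : ∀ a a′ (s t u : Tree γ) →
    (s ↩ᵗ[ a′ ] t) ↩ᵗ[ a ] u ≡ s ↩ᵗ[ a ↓ a′ ] (t ↩ᵗ[ a ] u)
  ↩ᵗ-↩ᵗ-assoc a a′ (node l leaf)       t u = refl
  ↩ᵗ-↩ᵗ-assoc a a′ (node l (edge y r)) t u =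
    cong (node l) (cong₂ edge (sym (↓-assoc a a′ y)) (↩ᵗ-↩ᵗ-assoc a a′ r t u))

  -- The mirror image: the path followed is the left one of `u`, hence the induction on the last
  -- tree.
  ↪ᵗ-↪ᵗ-assoc : ∀ a a′ (s t u : Tree γ) →
    (s ↪ᵗ[ a ] t) ↪ᵗ[ a ↓ a′ ] u ≡ s ↪ᵗ[ a ] (t ↪ᵗ[ a′ ] u)
  ↪ᵗ-↪ᵗ-assoc a a′ s t (node leaf       r) = refl
  ↪ᵗ-↪ᵗ-assoc a a′ s t (node (edge x l) r) =
    cong (λ l′ → node l′ r) (cong₂ edge (↓-assoc a a′ x) (↪ᵗ-↪ᵗ-assoc a a′ s t l))

-- Evaluation of trees in a multiplicial algebra.

module Evaluation {c ℓ} {K : Field c ℓ} {γ n ℓn}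
                  (B : MultiplicialAlgebra K γ n ℓn)
                  (b : MultiplicialAlgebra.Carrierᴹ B) where

  open MultiplicialAlgebra B
  open SetoidReasoning ≈ᴹ-setoid
  open IsModuleHomomorphism using (⟦⟧-cong)

  ↩-congˡ : ∀ a x {y z} → y ≈ᴹ z → (x ↩[ a ] y) ≈ᴹ (x ↩[ a ] z)
  ↩-congˡ a x = ⟦⟧-cong (↩-linearʳ a x)

  ↩-congʳ : ∀ a z {x y} → x ≈ᴹ y → (x ↩[ a ] z) ≈ᴹ (y ↩[ a ] z)
  ↩-congʳ a z = ⟦⟧-cong (↩-linearˡ a z)

  ↪-congˡ : ∀ a x {y z} → y ≈ᴹ z → (x ↪[ a ] y) ≈ᴹ (x ↪[ a ] z)
  ↪-congˡ a x = ⟦⟧-cong (↪-linearʳ a x)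

  ↪-congʳ : ∀ a z {x y} → x ≈ᴹ y → (x ↪[ a ] z) ≈ᴹ (y ↪[ a ] z)
  ↪-congʳ a z = ⟦⟧-cong (↪-linearˡ a z)

  -- node l r is obtained from the one-node tree by first grafting l, then r.
  eval  : Tree γ → Carrierᴹ
  evalˡ : Child γ → Carrierᴹ
  eval (node l leaf)       = evalˡ l
  eval (node l (edge a r)) = evalˡ l ↩[ a ] eval r
  evalˡ leaf       = b
  evalˡ (edge a l) = eval l ↪[ a ] b

  -- Induction down the right path of `s`: the relabelled edge `a ↓ y` is exactly the label at which
  -- `↩-↩-assoc`, read from right to left, moves the product by `eval t` outside.
  eval-↩ : ∀ a s t → eval (s ↩ᵗ[ a ] t) ≈ᴹ (eval s ↩[ a ] eval t)
  eval-↩ a (node l leaf)       t = ≈ᴹ-refl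
  eval-↩ a (node l (edge y r)) t = begin
    evalˡ l ↩[ a ↓ y ] eval (r ↩ᵗ[ a ] t)      ≈⟨ ↩-congˡ (a ↓ y) (evalˡ l) (eval-↩ a r t) ⟩
    evalˡ l ↩[ a ↓ y ] (eval r ↩[ a ] eval t)  ≈⟨ ↩-↩-assoc a y (evalˡ l) (eval r) (eval t) ⟨
    (evalˡ l ↩[ y ] eval r) ↩[ a ] eval t      ∎

  -- Since s ↪ commutes with grafting on the right, only the left child matters.
  eval-↪-node : ∀ a s l l′ r → evalˡ l′ ≈ᴹ (eval s ↪[ a ] evalˡ l) →
                eval (node l′ r) ≈ᴹ (eval s ↪[ a ] eval (node l r))
  eval-↪-node a s l l′ leaf       eq = eq
  eval-↪-node a s l l′ (edge y r) eq = begin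
    evalˡ l′ ↩[ y ] eval r                 ≈⟨ ↩-congʳ y (eval r) eq ⟩
    (eval s ↪[ a ] evalˡ l) ↩[ y ] eval r  ≈⟨ ↪-↩-assoc y a (eval s) (evalˡ l) (eval r) ⟩
    eval s ↪[ a ] (evalˡ l ↩[ y ] eval r)  ∎

  -- Induction down the left path of `t`, with `↪-↪-assoc` absorbing the relabelling `a ↓ x`.
  eval-↪ : ∀ a s t → eval (s ↪ᵗ[ a ] t) ≈ᴹ (eval s ↪[ a ] eval t)
  eval-↪ a s (node leaf       r) = eval-↪-node a s leaf (edge a s) r ≈ᴹ-refl
  eval-↪ a s (node (edge x l) r) =
    eval-↪-node a s (edge x l) (edge (a ↓ x) (s ↪ᵗ[ a ] l)) r (begin
      eval (s ↪ᵗ[ a ] l) ↪[ a ↓ x ] b      ≈⟨ ↪-congʳ (a ↓ x) b (eval-↪ a s l) ⟩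
      (eval s ↪[ a ] eval l) ↪[ a ↓ x ] b  ≈⟨ ↪-↪-assoc a x (eval s) (eval l) b ⟩
      eval s ↪[ a ] (eval l ↪[ x ] b)      ∎)

  module _ (φ : Tree γ → Carrierᴹ)
           (φ-generator : φ (node leaf leaf) ≈ᴹ b)
           (φ-↩ : ∀ a s t → φ (s ↩ᵗ[ a ] t) ≈ᴹ (φ s ↩[ a ] φ t))
           (φ-↪ : ∀ a s t → φ (s ↪ᵗ[ a ] t) ≈ᴹ (φ s ↪[ a ] φ t)) where

    -- By computation, `node l (edge a r)` is the graft of `r` on `node l leaf`, and
    -- `node (edge a l) leaf` is the graft of `l` on the one-node tree. Compatibility with grafting
    -- therefore forces every value of `φ`.
    eval-unique  : ∀ t → eval t ≈ᴹ φ t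
    evalˡ-unique : ∀ l → evalˡ l ≈ᴹ φ (node l leaf)
    eval-unique (node l leaf)       = evalˡ-unique l
    eval-unique (node l (edge a r)) = begin
      evalˡ l ↩[ a ] eval r               ≈⟨ ↩-congʳ a (eval r) (evalˡ-unique l) ⟩
      φ (node l leaf) ↩[ a ] eval r       ≈⟨ ↩-congˡ a (φ (node l leaf)) (eval-unique r) ⟩
      φ (node l leaf) ↩[ a ] φ r          ≈⟨ φ-↩ a (node l leaf) r ⟨
      φ (node l (edge a r))               ∎
    evalˡ-unique leaf       = ≈ᴹ-sym φ-generator
    evalˡ-unique (edge a l) = begin
      eval l ↪[ a ] b                     ≈⟨ ↪-congʳ a b (eval-unique l) ⟩
      φ l ↪[ a ] b                        ≈⟨ ↪-congˡ a (φ l) φ-generator ⟨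
      φ l ↪[ a ] φ (node leaf leaf)       ≈⟨ φ-↪ a l (node leaf leaf) ⟨
      φ (node (edge a l) leaf)            ∎

-- Freeness of the tree algebra.

theorem6p1p6 : ∀ {c ℓ} (K : Field c ℓ) → CharacteristicZero K → (γ : ℕ) →
    IsFreeMultiplicialAlgebraOnOneGenerator (treeAlgebra K γ)
theorem6p1p6 K _ γ = record
  { isMultiplicialAlgebra = record
    { ↩-linearˡ = λ a → bilinear-linearˡ (_↩ᵗ[ a ]_)
    ; ↩-linearʳ = λ a → bilinear-linearʳ (_↩ᵗ[ a ]_)
    ; ↪-linearˡ = λ a → bilinear-linearˡ (_↪ᵗ[ a ]_)
    ; ↪-linearʳ = λ a → bilinear-linearʳ (_↪ᵗ[ a ]_)
    ; ↪-↩-assoc = λ a a′ → bilinear-assoc _ _ _ _ (↪ᵗ-↩ᵗ-assoc a a′)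
    ; ↩-↩-assoc = λ a a′ → bilinear-assoc _ _ _ _ (↩ᵗ-↩ᵗ-assoc a a′)
    ; ↪-↪-assoc = λ a a′ → bilinear-assoc _ _ _ _ (↪ᵗ-↪ᵗ-assoc a a′)
    }
  ; generator = ⟨ node leaf leaf ⟩
  ; universal = λ B b →
      let open MultiplicialAlgebra B
          open Evaluation B b
      in extend vectorSpace eval
       , ( record
           { isModuleHomomorphism = extend-linear vectorSpace eval
           ; ↩-homo = λ a → extend-bilinear vectorSpace (_↩ᵗ[ a ]_) (_↩[ a ]_)
                              (↩-linearˡ a) (↩-linearʳ a) eval (eval-↩ a)
           ; ↪-homo = λ a → extend-bilinear vectorSpace (_↪ᵗ[ a ]_) (_↪[ a ]_)
                              (↪-linearˡ a) (↪-linearʳ a) eval (eval-↪ a)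
           }
         , extend-⟨⟩ vectorSpace eval (node leaf leaf)
         )
       , λ {g} (g-homo , g-generator) →
           let module G = IsMultiplicialHomomorphism g-homo
               g-cong = IsModuleHomomorphism.⟦⟧-cong G.isModuleHomomorphism
           in linear-ext vectorSpace (extend-linear vectorSpace eval) G.isModuleHomomorphism
                λ t → ≈ᴹ-trans (extend-⟨⟩ vectorSpace eval t)
                  -- A competing homomorphism is restricted to basis trees. A product of basis
                  -- vectors has coefficient `1# * 1#`, so it is a basis vector only up to `≋`, and
                  -- `g-cong` has to intervene.
                  (eval-unique (λ s → g ⟨ s ⟩) g-generator
                    (λ a s t → ≈ᴹ-trans (g-cong (≈ᴹ-sym′ (bilinear-⟨⟩ (_↩ᵗ[ a ]_) s t)))
                                        (G.↩-homo a ⟨ s ⟩ ⟨ t ⟩))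
                    (λ a s t → ≈ᴹ-trans (g-cong (≈ᴹ-sym′ (bilinear-⟨⟩ (_↪ᵗ[ a ]_) s t)))
                                        (G.↪-homo a ⟨ s ⟩ ⟨ t ⟩))
                    t)
  }
  where
  open FormalSumProperties (Field.commutativeRing K) (_≟ᵗ_ {γ})
  open Module (RawMultiplicialAlgebra.vectorSpace (treeAlgebra K γ))
    using () renaming (≈ᴹ-sym to ≈ᴹ-sym′)
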